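{- For rational numbers $f,g$ and a list of coefficients write $$[c_0,c_1,\dots,c_{10}]=\sum_{j=0}^{10}c_jf^{10-j}g^{j}.$$ For all rational numbers $f,g$, define $$\begin{aligned} x_1&=[1701,3888,459,1656,-5310,2504,-1482,616,25,-24,-1],\\ x_2&=[243,1944,4509,-5256,-1314,-3112,42,40,-17,48,-7],\\ x_3&=[-1215,-972,2403,1872,4770,4088,798,208,157,-12,-1],\\ x_4&=[-1215,-2916,459,1656,4122,-832,1878,-248,-59,36,-1],\\ x_5&=[243,972,-3591,-936,126,-1600,354,-728,-17,-12,5],\\ x_6&=[243,-2916,-4239,1008,-2394,-1048,-1590,112,-89,-36,5],\\ y_1&=[243,-1944,-675,5544,4446,2504,1770,184,-17,48,-7],\\ y_2&=[-1215,-972,459,-6552,-1062,-1600,-42,-104,133,12,-1],\\ y_3&=[243,-972,-4239,1872,-2394,4088,-1590,208,-89,-12,5],\\ y_4&=[243,2916,1593,-2232,-5634,-832,-1374,184,-17,-36,5],\\ y_5&=[1701,3888,459,360,-126,-3112,438,-584,-167,24,-1],\\ y_6&=[-1215,-2916,2403,1008,4770,-1048,798,112,157,-36,-1]. \end{aligned}$$ Then $\sum_{i=1}^6x_i=\sum_{i=1}^6y_i=0$ and $$\sum_{i=1}^6x_i^r=\sum_{i=1}^6y_i^r\qquad\text{for } r=1,2,3,4,5,7.$$ Moreover, as a parametric solution this is nontrivial and nonsymmetric: in $\mathbb{Q}[f,g]$ the multisets $\{x_1,\dots,x_6\}$ and $\{y_1,\dots,y_6\}$ are distinct, and it is not the case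 that both $\{x_1,\dots,x_6\}=\{ -x_1,\dots,-x_6\}$ and $\{y_1,\dots,y_6\}=\{ -y_1,\dots,-y_6\}$ as multisets.
   Context: An ideal solution of the Tarry-Escott problem of degree $k$ consists of two distinct multisets $\{x_1,\dots,x_{k+1}\}$, $\{y_1,\dots,y_{k+1}\}$ with $\sum x_i^r=\sum y_i^r$ for $r=1,\dots,k$. For $k=5$, a solution with $\sum x_i=\sum y_i=0$ is symmetric if, after rearrangement, $x_i=-x_{7-i}$ and $y_i=-y_{7-i}$ for $i=1,2,3$, and nonsymmetric otherwise. -}

module Defs where

import Algebra.Definitions.RawSemiring
open import Data.Bool.Base using (if_then_else_; _∧_)
open import Data.Fin.Base using (toℕ)
open import Data.Integer.Base using (ℤ)
import Data.Integer.Literals as ℤ-Literals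
open import Data.List.Base using (List; []; _∷_; map; foldr; tabulate)
open import Data.Nat.Base using (ℕ; _∸_; _≡ᵇ_)
open import Data.Product.Base using (_×_; _,_)
open import Data.Rational.Base using (ℚ; 0ℚ; _+_; _*_; -_; +-*-rawSemiring)
open import Data.Rational.Literals using (fromℤ)
open import Data.Unit.Base using (⊤; tt)
open import Data.Vec.Base using (Vec; []; _∷_; lookup)
open import Level using (0ℓ)
open import Relation.Binary.Bundles using (Setoid)
open import Relation.Binary.PropositionalEquality using (_≡_; refl; sym; trans)

import Data.List.Relation.Binary.Permutation.Setoid as Permutation

open Algebra.Definitions.RawSemiring +-*-rawSemiring public using (_^_)

sumℚ : List ℚ → ℚ
sumℚ = foldr _+_ 0ℚ

-- An element of ℚ[f,g] is represented by a formal sum of terms; the term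
-- (c , a , b) stands for c f^a g^b.  Exponent pairs may repeat, so equality
-- in ℚ[f,g] is _≈_ below (equality of all coefficients), not _≡_.
ℚ[f,g] : Set
ℚ[f,g] = List (ℚ × ℕ × ℕ)

coeff : ℚ[f,g] → ℕ → ℕ → ℚ
coeff p a b =
  sumℚ (map (λ (c , a′ , b′) → if (a ≡ᵇ a′) ∧ (b ≡ᵇ b′) then c else 0ℚ) p)

infix 4 _≈_
_≈_ : ℚ[f,g] → ℚ[f,g] → Set
p ≈ q = ∀ a b → coeff p a b ≡ coeff q a b

polySetoid : Setoid 0ℓ 0ℓ
polySetoid = record
  { Carrier       = ℚ[f,g]
  ; _≈_           = _≈_
  ; isEquivalence = record
    { refl  = λ _ _ → refl
    ; sym   = λ e a b → sym (e a b)
    ; trans = λ d e a b → trans (d a b) (e a b)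
    }
  }

-- Finite multisets in ℚ[f,g] are lists, with equality of multisets being
-- permutation up to _≈_.
open Permutation polySetoid public using () renaming (_↭_ to _≈ₘ_)

neg : ℚ[f,g] → ℚ[f,g]
neg = map (λ (c , a , b) → (- c , a , b))

eval : ℚ[f,g] → ℚ → ℚ → ℚ
eval p f g = sumℚ (map (λ (c , a , b) → c * (f ^ a * g ^ b)) p)

form : Vec ℤ 11 → ℚ[f,g]
form c = tabulate (λ j → (fromℤ (lookup c j) , 10 ∸ toℕ j , toℕ j))

open import Agda.Builtin.FromNat using (Number; fromNat)
open import Agda.Builtin.FromNeg using (Negative; fromNeg)

private instance
  numberℤ : Number ℤ
  numberℤ = ℤ-Literals.number

  negativeℤ : Negative ℤ
  negativeℤ = ℤ-Literals.negative

  unit : ⊤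
  unit = tt

x₁ x₂ x₃ x₄ x₅ x₆ y₁ y₂ y₃ y₄ y₅ y₆ : ℚ[f,g]
x₁ = form (1701 ∷ 3888 ∷ 459 ∷ 1656 ∷ -5310 ∷ 2504 ∷ -1482 ∷ 616 ∷ 25 ∷ -24 ∷ -1 ∷ [])
x₂ = form (243 ∷ 1944 ∷ 4509 ∷ -5256 ∷ -1314 ∷ -3112 ∷ 42 ∷ 40 ∷ -17 ∷ 48 ∷ -7 ∷ [])
x₃ = form (-1215 ∷ -972 ∷ 2403 ∷ 1872 ∷ 4770 ∷ 4088 ∷ 798 ∷ 208 ∷ 157 ∷ -12 ∷ -1 ∷ [])
x₄ = form (-1215 ∷ -2916 ∷ 459 ∷ 1656 ∷ 4122 ∷ -832 ∷ 1878 ∷ -248 ∷ -59 ∷ 36 ∷ -1 ∷ [])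
x₅ = form (243 ∷ 972 ∷ -3591 ∷ -936 ∷ 126 ∷ -1600 ∷ 354 ∷ -728 ∷ -17 ∷ -12 ∷ 5 ∷ [])
x₆ = form (243 ∷ -2916 ∷ -4239 ∷ 1008 ∷ -2394 ∷ -1048 ∷ -1590 ∷ 112 ∷ -89 ∷ -36 ∷ 5 ∷ [])
y₁ = form (243 ∷ -1944 ∷ -675 ∷ 5544 ∷ 4446 ∷ 2504 ∷ 1770 ∷ 184 ∷ -17 ∷ 48 ∷ -7 ∷ [])
y₂ = form (-1215 ∷ -972 ∷ 459 ∷ -6552 ∷ -1062 ∷ -1600 ∷ -42 ∷ -104 ∷ 133 ∷ 12 ∷ -1 ∷ [])
y₃ = form (243 ∷ -972 ∷ -4239 ∷ 1872 ∷ -2394 ∷ 4088 ∷ -1590 ∷ 208 ∷ -89 ∷ -12 ∷ 5 ∷ [])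
y₄ = form (243 ∷ 2916 ∷ 1593 ∷ -2232 ∷ -5634 ∷ -832 ∷ -1374 ∷ 184 ∷ -17 ∷ -36 ∷ 5 ∷ [])
y₅ = form (1701 ∷ 3888 ∷ 459 ∷ 360 ∷ -126 ∷ -3112 ∷ 438 ∷ -584 ∷ -167 ∷ 24 ∷ -1 ∷ [])
y₆ = form (-1215 ∷ -2916 ∷ 2403 ∷ 1008 ∷ 4770 ∷ -1048 ∷ 798 ∷ 112 ∷ 157 ∷ -36 ∷ -1 ∷ [])

xs ys : List ℚ[f,g]
xs = x₁ ∷ x₂ ∷ x₃ ∷ x₄ ∷ x₅ ∷ x₆ ∷ []
ys = y₁ ∷ y₂ ∷ y₃ ∷ y₄ ∷ y₅ ∷ y₆ ∷ []

{-# OPTIONS --safe #-}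

-- The power sum identities already hold in ℤ[f,g], where both sides are
-- compared by computing their Horner normal forms with the polynomial
-- arithmetic of the standard library's ring solver; evaluation ℤ[f,g] → ℚ is
-- a homomorphism.  Equal multisets of polynomials have equal multisets of
-- coefficients at each monomial: at f⁶g⁴ the value -5310 of x₁ is attained by
-- no yᵢ, and at f¹⁰ the value 1701 of x₁ is attained by no -xᵢ.
module Submission where

open import Defs
open import Data.Bool.Base using (true; false)
open import Data.Fin.Base using (zero; suc)
open import Data.Integer.Base as ℤ using (+0; +[1+_]; -[1+_])
import Data.Integer.Properties as ℤ
open import Data.List.Base using (List; []; _∷_; map; foldr)
open import Data.List.Membership.Propositional using (_∈_)
open import Data.List.Relation.Unary.All as All using (All; []; _∷_)
open import Data.List.Relation.Unary.Any using (here; there)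
open import Data.Maybe.Base using (nothing)
open import Data.Nat.Base using (ℕ)
open import Data.Product.Base using (_×_; _,_)
open import Data.Rational.Base using (ℚ; 0ℚ; _+_; _*_; -_; ↥_)
open import Data.Rational.Literals using (fromℤ)
open import Data.Rational.Properties as ℚ using (_≟_; toℚᵘ-injective)
open import Data.Rational.Unnormalised.Base using (*≡*)
import Data.Rational.Unnormalised.Properties as ℚᵘ
open import Data.Vec.Base as Vec using (Vec)
open import Relation.Binary.PropositionalEquality
  using (_≡_; refl; sym; trans; cong; cong₂; setoid; module ≡-Reasoning)
open import Relation.Nullary.Decidable using (from-no; from-yes)
open import Relation.Nullary.Negation using (¬_)
open import Relation.Unary using (Decidable)
import Algebra.Properties.Monoid.Mult.TCOptimised as TCOptimised
import Data.List.Membership.DecPropositional as DecMembership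
import Data.List.Relation.Binary.Permutation.Setoid.Properties as Permutation
open import Tactic.RingSolver.Core.AlmostCommutativeRing using (fromCommutativeRing)
open import Tactic.RingSolver.Core.Polynomial.Parameters using (Homomorphism)

-- Addition in ℚ reduces by a gcd, which is stuck on variables, so the comparison takes place among
-- unnormalised fractions: there both denominators are 1 and only factors of 1 have to be cleared.
fromℤ-+ : ∀ a b → fromℤ (a ℤ.+ b) ≡ fromℤ a + fromℤ b
fromℤ-+ a b = toℚᵘ-injective (ℚᵘ.≃-trans
  (*≡* (cong (ℤ._* ℤ.1ℤ) (sym (cong₂ ℤ._+_ (ℤ.*-identityʳ a) (ℤ.*-identityʳ b)))))
  (ℚᵘ.≃-sym (ℚ.toℚᵘ-homo-+ (fromℤ a) (fromℤ b))))

fromℤ-* : ∀ a b → fromℤ (a ℤ.* b) ≡ fromℤ a * fromℤ b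
fromℤ-* a b = toℚᵘ-injective (ℚᵘ.≃-sym (ℚ.toℚᵘ-homo-* (fromℤ a) (fromℤ b)))

fromℤ-neg : ∀ a → fromℤ (ℤ.- a) ≡ - fromℤ a
fromℤ-neg +0       = refl
fromℤ-neg +[1+ _ ] = refl
fromℤ-neg -[1+ _ ] = refl

ℤ⟶ℚ : Homomorphism _ _ _ _
ℤ⟶ℚ = record
  { from = record
    { rawRing = ℤ.+-*-rawRing
    -- An exact zero test lets cancelled coefficients disappear from Horner forms, so equal
    -- polynomials can be compared by `refl`.
    ; isZero  = λ { +0 → true ; _ → false }
    }
  ; to = fromCommutativeRing ℚ.+-*-commutativeRing (λ _ → nothing)
  ; morphism = record
    { ⟦_⟧    = fromℤ
    ; +-homo = fromℤ-+
    ; *-homo = fromℤ-*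
    ; -‿homo = fromℤ-neg
    ; 0-homo = refl
    ; 1-homo = refl
    }
  ; Zero-C⟶Zero-R = λ { +0 _ → refl }
  }

open import Tactic.RingSolver.Core.Polynomial.Base (Homomorphism.from ℤ⟶ℚ)
  using (Poly; κ; ι; _⊞_; _⊠_; _⊡_)
open import Tactic.RingSolver.Core.Polynomial.Semantics ℤ⟶ℚ using (⟦_⟧)
open import Tactic.RingSolver.Core.Polynomial.Homomorphism ℤ⟶ℚ
  using (⊞-hom; ⊠-hom; ⊡-hom; ι-hom)

sumₚ : ∀ {n} → List (Poly n) → Poly n
sumₚ = foldr _⊞_ (κ ℤ.0ℤ)

-- Serves two levels: terms within one polynomial, and polynomials or their powers within a list.
-- The premise is an `All` because evaluation is known to agree only at integral entries.
⟦sumₚ⟧ : ∀ {n} {A : Set} (p : A → Poly n) (h : A → ℚ) (ρ : Vec ℚ n) {as : List A} →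
         All (λ a → ⟦ p a ⟧ ρ ≡ h a) as →
         ⟦ sumₚ (map p as) ⟧ ρ ≡ sumℚ (map h as)
⟦sumₚ⟧ p h ρ [] = refl
⟦sumₚ⟧ p h ρ (_∷_ {x = a} {xs = as} e es) =
  trans (⊞-hom (p a) (sumₚ (map p as)) ρ) (cong₂ _+_ e (⟦sumₚ⟧ p h ρ es))

-- ⊡-hom is stated for the power _^′_ optimised for type checking, eval for the
-- plain one; they agree only propositionally.
⟦⊡⟧ : ∀ {n} (p : Poly n) r ρ → ⟦ p ⊡ r ⟧ ρ ≡ ⟦ p ⟧ ρ ^ r
⟦⊡⟧ p r ρ = trans (⊡-hom p r ρ) (sym (TCOptimised.×ᵤ≈× ℚ.*-1-monoid r (⟦ p ⟧ ρ)))

-- This is what makes it lossless for `monomial` to keep only the numerator of each coefficient.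
Integral : ℚ[f,g] → Set
Integral = All (λ (c , _ , _) → fromℤ (↥ c) ≡ c)

monomial : ℚ × ℕ × ℕ → Poly 2
monomial (c , a , b) = κ (↥ c) ⊠ (ι zero ⊡ a ⊠ ι (suc zero) ⊡ b)

normal : ℚ[f,g] → Poly 2
normal p = sumₚ (map monomial p)

powerSum : ℕ → List ℚ[f,g] → Poly 2
powerSum r ps = sumₚ (map (λ p → normal p ⊡ r) ps)

module _ (f g : ℚ) where

  private
    ρ : Vec ℚ 2
    ρ = f Vec.∷ g Vec.∷ Vec.[]

  ⟦monomial⟧ : ∀ c a b → fromℤ (↥ c) ≡ c →
               ⟦ monomial (c , a , b) ⟧ ρ ≡ c * (f ^ a * g ^ b)
  ⟦monomial⟧ c a b c∈ℤ = begin
    ⟦ monomial (c , a , b) ⟧ ρ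
      ≡⟨ ⊠-hom (κ (↥ c)) (ι zero ⊡ a ⊠ ι (suc zero) ⊡ b) ρ ⟩
    fromℤ (↥ c) * ⟦ ι zero ⊡ a ⊠ ι (suc zero) ⊡ b ⟧ ρ
      ≡⟨ cong₂ _*_ c∈ℤ (⊠-hom (ι zero ⊡ a) (ι (suc zero) ⊡ b) ρ) ⟩
    c * (⟦ ι zero ⊡ a ⟧ ρ * ⟦ ι (suc zero) ⊡ b ⟧ ρ)
      ≡⟨ cong (c *_) (cong₂ _*_ (power zero a) (power (suc zero) b)) ⟩
    c * (f ^ a * g ^ b) ∎
    where
    open ≡-Reasoning
    power : ∀ i n → ⟦ ι i ⊡ n ⟧ ρ ≡ Vec.lookup ρ i ^ n
    power i n = trans (⟦⊡⟧ (ι i) n ρ) (cong (_^ n) (ι-hom i ρ))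

  ⟦normal⟧ : ∀ {p} → Integral p → ⟦ normal p ⟧ ρ ≡ eval p f g
  ⟦normal⟧ p∈ℤ = ⟦sumₚ⟧ monomial _ ρ (All.map (λ { {c , a , b} → ⟦monomial⟧ c a b }) p∈ℤ)

  sum-zero : ∀ {ps} → All Integral ps → sumₚ (map normal ps) ≡ κ ℤ.0ℤ →
             sumℚ (map (λ p → eval p f g) ps) ≡ 0ℚ
  sum-zero ps∈ℤ ps≡0 =
    trans (sym (⟦sumₚ⟧ normal _ ρ (All.map (λ {p} → ⟦normal⟧ {p}) ps∈ℤ)))
      (cong (λ p → ⟦ p ⟧ ρ) ps≡0)

  ⟦powerSum⟧ : ∀ r {ps} → All Integral ps →
               ⟦ powerSum r ps ⟧ ρ ≡ sumℚ (map (λ p → eval p f g ^ r) ps)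
  ⟦powerSum⟧ r ps∈ℤ = ⟦sumₚ⟧ (λ p → normal p ⊡ r) _ ρ
    (All.map (λ {p} p∈ℤ → trans (⟦⊡⟧ (normal p) r ρ) (cong (_^ r) (⟦normal⟧ {p} p∈ℤ))) ps∈ℤ)

  powerSum-cong : ∀ r {ps qs} → All Integral ps → All Integral qs →
                  powerSum r ps ≡ powerSum r qs →
                  sumℚ (map (λ p → eval p f g ^ r) ps) ≡ sumℚ (map (λ p → eval p f g ^ r) qs)
  powerSum-cong r ps∈ℤ qs∈ℤ ps≡qs =
    trans (sym (⟦powerSum⟧ r ps∈ℤ)) (trans (cong (λ p → ⟦ p ⟧ ρ) ps≡qs) (⟦powerSum⟧ r qs∈ℤ))

integral? : Decidable Integral
integral? = All.all? (λ (c , _ , _) → fromℤ (↥ c) ≟ c)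

xs-integral : All Integral xs
xs-integral = from-yes (All.all? integral? xs)

ys-integral : All Integral ys
ys-integral = from-yes (All.all? integral? ys)

sum-xs : sumₚ (map normal xs) ≡ κ ℤ.0ℤ
sum-xs = refl

sum-ys : sumₚ (map normal ys) ≡ κ ℤ.0ℤ
sum-ys = refl

-- Matching on the membership proof turns `r` into a numeral. Both sides are then closed terms over
-- ℤ, and `refl` expands them to Horner form without mentioning any values of f and g.
powerSums-agree : ∀ {r} → r ∈ 1 ∷ 2 ∷ 3 ∷ 4 ∷ 5 ∷ 7 ∷ [] → powerSum r xs ≡ powerSum r ys
powerSums-agree (here refl)                                         = refl
powerSums-agree (there (here refl))                                 = refl
powerSums-agree (there (there (here refl)))                         = refl
powerSums-agree (there (there (there (here refl))))                 = refl
powerSums-agree (there (there (there (there (here refl)))))         = refl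
powerSums-agree (there (there (there (there (there (here refl)))))) = refl

-- Taking a fixed coefficient respects `_≈_`, so it carries the permutation to one of lists of
-- rationals up to `_≡_`, where membership is decidable. Following the head is enough, since `x₁`
-- supplies both distinguishing values.
coeff-∈ : ∀ {p ps qs} a b → p ∷ ps ≈ₘ qs → coeff p a b ∈ map (λ q → coeff q a b) qs
coeff-∈ a b perm = Permutation.∈-resp-↭ (setoid ℚ)
  (Permutation.map⁺ polySetoid (setoid ℚ) (λ p≈q → p≈q a b) perm) (here refl)

open DecMembership _≟_ using (_∈?_)

xs≉ys : ¬ (xs ≈ₘ ys)
xs≉ys xs≈ys = from-no (coeff x₁ 6 4 ∈? map (λ q → coeff q 6 4) ys) (coeff-∈ 6 4 xs≈ys)

xs≉-xs : ¬ (xs ≈ₘ map neg xs)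
xs≉-xs xs≈-xs =
  from-no (coeff x₁ 10 0 ∈? map (λ q → coeff q 10 0) (map neg xs)) (coeff-∈ 10 0 xs≈-xs)

mainTheorem5 : (∀ (f g : ℚ) →
    sumℚ (map (λ p → eval p f g) xs) ≡ 0ℚ
    × sumℚ (map (λ p → eval p f g) ys) ≡ 0ℚ
    × (∀ (r : ℕ) → r ∈ 1 ∷ 2 ∷ 3 ∷ 4 ∷ 5 ∷ 7 ∷ [] →
    sumℚ (map (λ p → eval p f g ^ r) xs) ≡ sumℚ (map (λ p → eval p f g ^ r) ys)))
    × ¬ (xs ≈ₘ ys)
    × ¬ ((xs ≈ₘ map neg xs) × (ys ≈ₘ map neg ys))
-- Without the explicit {xs} and {ys}, solving for them makes Agda unfold both
-- sides down to rational arithmetic.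
mainTheorem5 =
    (λ f g → sum-zero f g {xs} xs-integral sum-xs
           , sum-zero f g {ys} ys-integral sum-ys
           , λ r r∈ → powerSum-cong f g r {xs} {ys} xs-integral ys-integral (powerSums-agree r∈))
  , xs≉ys
  , λ (xs≈-xs , _) → xs≉-xs xs≈-xs
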